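{- For a positive integer $k$, let $\mathcal{G}_{+,k}$ be the set of graphs $G$ with at most $2k$ vertices such that there exist a PSD forcing set $B$ of $G$ and a set of PSD forces $\mathcal{F}$ of $B$ with $\operatorname{pt}_+(G;B)=\operatorname{pt}_+(G;\mathcal{F})=1$ and $|\mathcal{F}^{(1)}|=k$. (1) If a graph $G$ contains a graph in $\mathcal{G}_{+,k}$ as an induced subgraph, then $|V(G)|-k\geq\operatorname{th}^*_{+}(G)$. (2) Suppose $G$ is a non-empty graph on $n$ vertices that does not contain a graph in $\mathcal{G}_{+,k}$ as an induced subgraph. If $1<k<(n/12)^{1/3}$, then $\operatorname{th}^*_{+}(G)=k_{+}(G,1)>|V(G)|-k$.
   Context: All graphs are simple, finite and undirected. PSD color change rule: given the current blue set $B\subseteq V(G)$, let $W_1,\dots,W_m$ be the vertex sets of the components of $G-B$; a blue vertex $v$ can force $w$ (turn it blue) if $w$ is the unique white neighbor of $v$ in $G[B\cup W_i]$ for some $i$. From an initial blue set $B$, applying valid forces until none is possible yields a final coloring; $B$ is a PSD forcing set if this is all of $V(G)$. The set of forces in a chronological list of forces so performed is a set of PSD forces of $B$. For such $\mathcal{F}$: $\mathcal{F}^{(0)}=B$; for $t>0$, with $\bigcup_{i<t}\mathcal{F}^{(i)}$ blue, $\mathcal{F}^{(t)}$ is the set of white $w$ for which there is a blue $b$ with $(b\rightarrow w)\in\mathcal{F}$ valid; $\mathcal{F}^{[t]}=\bigcup_{i\le t}\mathcal{F}^{(i)}$. $\operatorname{pt}_+(G;\mathcal{F})$ is the least $q$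 with $\mathcal{F}^{[q]}=V(G)$ ($\infty$ if none); $\operatorname{pt}_+(G;B)$ is its minimum over sets of PSD forces of $B$. The (no initial cost) PSD product throttling number is $\operatorname{th}^*_+(G)=\min\{|B|\cdot\operatorname{pt}_+(G;B): B\subsetneq V(G)\}$, and $k_+(G,p)$ is the minimum cardinality of a PSD forcing set $B$ of $G$ with $\operatorname{pt}_+(G;B)=p$. -}

module Defs where

open import Data.Nat using (ℕ; zero; suc; _+_; _*_; _^_; _≤_; _<_)
open import Data.Fin using (Fin)
open import Data.Fin.Subset using (Subset; _∈_; _∉_; ∣_∣)
open import Data.Bool using (Bool; true; false)
open import Data.List using (List; []; _∷_)
open import Data.List.Membership.Propositional using () renaming (_∈_ to _∈ₗ_)
open import Data.Product using (Σ; ∃; ∃-syntax; _×_; _,_)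
open import Data.Sum using (_⊎_)
open import Data.Unit using (⊤)
open import Relation.Nullary using (¬_)
open import Relation.Binary.PropositionalEquality using (_≡_)
open import Function.Bundles using (_⇔_)
open import Function.Definitions using (Injective)

record Graph (n : ℕ) : Set where
  field
    adj    : Fin n → Fin n → Bool
    sym    : ∀ i j → adj i j ≡ adj j i
    irrefl : ∀ i → adj i i ≡ false
open Graph public

module _ {n : ℕ} (G : Graph n) where

  -- A coloring: the predicate "is blue"; white = not blue.
  Coloring : Set₁
  Coloring = Fin n → Set

  data WPath (Blue : Coloring) : Fin n → Fin n → Set where
    here : ∀ {u} → ¬ Blue u → WPath Blue u u
    step : ∀ {u w v} → ¬ Blue u → adj G u w ≡ true → WPath Blue w v → WPath Blue u v

  -- PSD color change rule: blue b can force white w iff w is the unique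
  -- white neighbour of b in G[Blue ∪ W], W the component of G - Blue containing w.
  ValidForce : Coloring → Fin n → Fin n → Set
  ValidForce Blue b w =
    Blue b × ¬ Blue w × adj G b w ≡ true ×
    (∀ u → ¬ Blue u → adj G b u ≡ true → WPath Blue w u → u ≡ w)

  addBlue : Coloring → Fin n → Coloring
  addBlue Blue w v = Blue v ⊎ v ≡ w

  -- Force list: pairs (b , w) meaning b → w, in chronological order.
  Force : Set
  Force = Fin n × Fin n

  after : Coloring → List Force → Coloring
  after Blue [] = Blue
  after Blue ((b , w) ∷ fs) = after (addBlue Blue w) fs

  ChronValid : Coloring → List Force → Set
  ChronValid Blue [] = ⊤
  ChronValid Blue ((b , w) ∷ fs) = ValidForce Blue b w × ChronValid (addBlue Blue w) fs

  toColoring : Subset n → Coloring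
  toColoring B v = v ∈ B

  IsPSDForces : Subset n → List Force → Set
  IsPSDForces B fs =
    ChronValid (toColoring B) fs ×
    (∀ b w → ¬ ValidForce (after (toColoring B) fs) b w)

  IsPSDForcingSet : Subset n → Set
  IsPSDForcingSet B = ∃[ fs ] (IsPSDForces B fs × (∀ v → after (toColoring B) fs v))

  -- F^[t] for a set of forces F (the list, used as a set via membership).
  Stage : Subset n → List Force → ℕ → Coloring
  Stage B fs zero = toColoring B
  Stage B fs (suc t) v =
    Stage B fs t v ⊎ (∃[ b ] ((b , v) ∈ₗ fs × ValidForce (Stage B fs t) b v))

  -- StageNew B fs t = F^(t+1): white w (w.r.t. F^[t]) forced by a valid force of F.
  StageNew : Subset n → List Force → ℕ → Coloring
  StageNew B fs t v = ∃[ b ] ((b , v) ∈ₗ fs × ValidForce (Stage B fs t) b v)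

  AllBlue : Coloring → Set
  AllBlue C = ∀ v → C v

  PtF : Subset n → List Force → ℕ → Set
  PtF B fs q = AllBlue (Stage B fs q) × (∀ q′ → q′ < q → ¬ AllBlue (Stage B fs q′))

  Pt : Subset n → ℕ → Set
  Pt B p =
    (∃[ fs ] (IsPSDForces B fs × PtF B fs p)) ×
    (∀ fs q → IsPSDForces B fs → PtF B fs q → p ≤ q)

  ProperSubset : Subset n → Set
  ProperSubset B = ∃[ v ] (v ∉ B)

  -- th*_+(G) = t (finite): min { |B| · pt_+(G;B) : B ⊊ V(G) }, with only
  -- finite values of pt_+ contributing.
  ThStar : ℕ → Set
  ThStar t =
    (∃[ B ] ∃[ p ] (ProperSubset B × Pt B p × ∣ B ∣ * p ≡ t)) ×
    (∀ B p → ProperSubset B → Pt B p → t ≤ ∣ B ∣ * p)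

  Kplus : ℕ → ℕ → Set
  Kplus p m =
    (∃[ B ] (IsPSDForcingSet B × Pt B p × ∣ B ∣ ≡ m)) ×
    (∀ B → IsPSDForcingSet B → Pt B p → m ≤ ∣ B ∣)

  NonEmpty : Set
  NonEmpty = ∃[ i ] ∃[ j ] (adj G i j ≡ true)

InGk : ℕ → {m : ℕ} → Graph m → Set
InGk k {m} H =
  m ≤ 2 * k ×
  (∃[ B ] ∃[ fs ]
    (IsPSDForcingSet H B × IsPSDForces H B fs × Pt H B 1 × PtF H B fs 1 ×
     (∃[ S ] ((∀ v → (v ∈ S) ⇔ StageNew H B fs 0 v) × ∣ S ∣ ≡ k))))

InducedSub : {m n : ℕ} → Graph m → Graph n → Set
InducedSub {m} {n} H G =
  ∃[ f ] (Injective _≡_ _≡_ f × (∀ i j → adj H i j ≡ adj G (f i) (f j)))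

ContainsGk : {n : ℕ} → Graph n → ℕ → Set
ContainsGk G k = ∃[ m ] Σ (Graph m) (λ H → InGk k H × InducedSub H G)

{-# OPTIONS --safe #-}

-- A set of white vertices that can all be forced at once, everything else being blue, stays
-- so when it shrinks, and k such vertices with their forcers induce a member of 𝒢₊,ₖ.
-- Conversely, a member of 𝒢₊,ₖ in G gives k vertices of G that the other n − k force in one step.
--
-- If G has no such subgraph, a forcing process from B with propagation time p colours at most
-- k − 1 vertices per step, so n ≤ |B| + p(k − 1). Moreover every vertex has at most |B| blue
-- neighbours when it is forced, so the forced vertices can be coloured greedily with |B| + 1
-- colours, and a colour class with k vertices would be an independent set that is forced at once;
-- so n ≤ |B| + (|B| + 1)(k − 1). For p ≥ 2 and n > 12k³ the two bounds give n ≤ p|B|, while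
-- an edge shows k₊(G,1) < n.

module Submission where

open import Defs
open import Data.Bool using (true; false)
import Data.Bool.Properties as Bool
open import Data.Nat using (ℕ; zero; suc; _+_; _*_; _^_; _≤_; _<_; _≤?_; z≤n; s≤s; s≤s⁻¹)
import Data.Nat.Properties as ℕ
open import Data.Fin using (Fin; zero; suc; toℕ)
open import Data.Fin.Properties using (_≟_; any?; all?; injective⇒≤; suc-injective; toℕ<n; toℕ-injective; ¬∀⟶∃¬)
open import Data.Fin.Subset using (Subset; inside; outside; _∈_; _∉_; ∣_∣; ∁)
open import Data.Fin.Subset.Properties using (_∈?_; anySubset?; ∣p∣≤n; ∣∁p∣≡n∸∣p∣; x∈∁p⇒x∉p; x∉p⇒x∈∁p)
open import Data.Vec using ([]; _∷_; here; there; tabulate)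
open import Data.Vec.Properties using (lookup∘tabulate; []=⇒lookup; lookup⇒[]=)
open import Data.List using (List; []; _∷_; _++_; map; length; lookup; filter; take; deduplicate; allFin)
open import Data.List.Properties using (length-map; length-take; length-++; length-deduplicate; length-tabulate)
open import Data.List.Membership.Propositional using () renaming (_∈_ to _∈ₗ_; _∉_ to _∉ₗ_)
open import Data.List.Membership.Propositional.Properties
  using (∈-map⁺; ∈-map⁻; ∈-filter⁺; ∈-filter⁻; ∈-deduplicate⁺; ∈-lookup; ∈-allFin; ∈-++⁺ˡ; ∈-++⁺ʳ)
open import Data.List.Relation.Binary.Subset.Propositional using () renaming (_⊆_ to _⊆ₗ_)
open import Data.List.Relation.Unary.All as All using ([]; _∷_)
open import Data.List.Relation.Unary.Any as Any using (here; there)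
open import Data.List.Relation.Unary.Any.Properties using (lookup-index)
open import Data.List.Relation.Unary.AllPairs using ([]; _∷_)
open import Data.List.Relation.Unary.Unique.Propositional using (Unique)
import Data.List.Relation.Unary.Unique.Propositional.Properties as Unique
open import Data.List.Relation.Unary.Unique.DecPropositional.Properties using (deduplicate-!)
open import Data.Product using (Σ; ∃; ∃-syntax; _×_; _,_; proj₁; proj₂)
import Data.Product.Properties as Product
open import Data.Sum using (_⊎_; inj₁; inj₂)
open import Data.Unit using (tt)
open import Function using (_∘_; id; _⇔_; mk⇔; Equivalence)
open import Function.Definitions using (Injective)
open import Relation.Nullary using (¬_; Dec; yes; no; does; contradiction; ¬?)
open import Relation.Nullary.Decidable using (map′; _×-dec_; _⊎-dec_; _→-dec_; decidable-stable; dec-true; dec-false)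
open import Relation.Unary using (Decidable)
open import Relation.Binary.PropositionalEquality
  using (_≡_; _≢_; refl; cong; cong₂; subst; trans; module ≡-Reasoning) renaming (sym to ≡-sym)

private
  variable
    A : Set
    m n : ℕ

-- Finite sets as lists and subsets

lookup-injective : {xs : List A} → Unique xs → Injective _≡_ _≡_ (lookup xs)
lookup-injective (x∉ ∷ !) {zero}  {zero}  eq = refl
lookup-injective {xs = x ∷ xs} (x∉ ∷ !) {zero}  {suc j} eq = contradiction eq (All.lookup x∉ (∈-lookup j))
lookup-injective {xs = x ∷ xs} (x∉ ∷ !) {suc i} {zero}  eq = contradiction (≡-sym eq) (All.lookup x∉ (∈-lookup i))
lookup-injective (x∉ ∷ !) {suc i} {suc j} eq = cong suc (lookup-injective ! eq)

∈⇒lookup : {xs : List A} {x : A} → x ∈ₗ xs → ∃[ i ] lookup xs i ≡ x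
∈⇒lookup x∈ = Any.index x∈ , ≡-sym (lookup-index x∈)

Unique-⊆⇒length≤ : {xs ys : List A} → Unique xs → xs ⊆ₗ ys → length xs ≤ length ys
Unique-⊆⇒length≤ {xs = xs} {ys} ! xs⊆ys = injective⇒≤ {f = proj₁ ∘ pos} inj
  where
  pos : ∀ i → ∃[ j ] lookup ys j ≡ lookup xs i
  pos i = ∈⇒lookup (xs⊆ys (∈-lookup i))
  inj : Injective _≡_ _≡_ (proj₁ ∘ pos)
  inj {i} {j} eq = lookup-injective !
    (trans (≡-sym (proj₂ (pos i))) (trans (cong (lookup ys) eq) (proj₂ (pos j))))

Unique⇒length≤n : {xs : List (Fin n)} → Unique xs → length xs ≤ n
Unique⇒length≤n {n = n} ! = ℕ.≤-trans (Unique-⊆⇒length≤ ! (λ {v} _ → ∈-allFin v)) (ℕ.≤-reflexive (length-tabulate id))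

nonempty : {xs : List A} → 0 < length xs → ∃ (_∈ₗ xs)
nonempty {xs = x ∷ xs} _ = x , here refl

∈-take⁻ : ∀ k {xs : List A} → take k xs ⊆ₗ xs
∈-take⁻ (suc k) {x ∷ xs} (here eq) = here eq
∈-take⁻ (suc k) {x ∷ xs} (there x∈) = there (∈-take⁻ k x∈)

elements : Subset n → List (Fin n)
elements []            = []
elements (inside ∷ p)  = zero ∷ map suc (elements p)
elements (outside ∷ p) = map suc (elements p)

length-elements : (p : Subset n) → length (elements p) ≡ ∣ p ∣
length-elements []            = refl
length-elements (inside ∷ p)  = cong suc (trans (length-map suc (elements p)) (length-elements p))
length-elements (outside ∷ p) = trans (length-map suc (elements p)) (length-elements p)

∈-elements⁺ : {p : Subset n} {v : Fin n} → v ∈ p → v ∈ₗ elements p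
∈-elements⁺ {p = inside ∷ p}  {zero}  here       = here refl
∈-elements⁺ {p = inside ∷ p}  {suc v} (there v∈) = there (∈-map⁺ suc (∈-elements⁺ v∈))
∈-elements⁺ {p = outside ∷ p} {suc v} (there v∈) = ∈-map⁺ suc (∈-elements⁺ v∈)

∈-elements⁻ : {p : Subset n} {v : Fin n} → v ∈ₗ elements p → v ∈ p
∈-elements⁻ {p = inside ∷ p}  (here refl) = here
∈-elements⁻ {p = inside ∷ p}  (there v∈) with _ , u∈ , refl ← ∈-map⁻ suc v∈ = there (∈-elements⁻ u∈)
∈-elements⁻ {p = outside ∷ p} v∈         with _ , u∈ , refl ← ∈-map⁻ suc v∈ = there (∈-elements⁻ u∈)

elements-! : (p : Subset n) → Unique (elements p)
elements-! []            = []
elements-! (inside ∷ p)  =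
  All.tabulate (λ v∈ 0≡v → contradiction (subst (_∈ₗ map suc (elements p)) (≡-sym 0≡v) v∈) 0∉) ∷
  Unique.map⁺ suc-injective (elements-! p)
  where
  0∉ : zero ∉ₗ map suc (elements p)
  0∉ 0∈ with () ← proj₂ (proj₂ (∈-map⁻ suc 0∈))
elements-! (outside ∷ p) = Unique.map⁺ suc-injective (elements-! p)

⟦_⟧ : {P : Fin n → Set} → Decidable P → Subset n
⟦ P? ⟧ = tabulate (does ∘ P?)

module _ {P : Fin n → Set} (P? : Decidable P) where

  ∈-⟦⟧⁺ : ∀ {v} → P v → v ∈ ⟦ P? ⟧
  ∈-⟦⟧⁺ {v} Pv = lookup⇒[]= v _ (trans (lookup∘tabulate _ v) (dec-true (P? v) Pv))

  ∈-⟦⟧⁻ : ∀ {v} → v ∈ ⟦ P? ⟧ → P v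
  ∈-⟦⟧⁻ {v} v∈ = decidable-stable (P? v) λ ¬Pv → contradiction
    (trans (≡-sym (trans (lookup∘tabulate _ v) (dec-false (P? v) ¬Pv))) ([]=⇒lookup v∈)) λ ()

Unique⇒length≡∣∣ : {xs : List (Fin n)} {p : Subset n} → Unique xs →
  (∀ v → v ∈ₗ xs ⇔ v ∈ p) → length xs ≡ ∣ p ∣
Unique⇒length≡∣∣ {xs = xs} {p} ! xs⇔p = trans
  (ℕ.≤-antisym
    (Unique-⊆⇒length≤ ! (λ {v} → ∈-elements⁺ ∘ Equivalence.to (xs⇔p v)))
    (Unique-⊆⇒length≤ (elements-! p) (λ {v} → Equivalence.from (xs⇔p v) ∘ ∈-elements⁻)))
  (length-elements p)

∣p∣+∣∁p∣≡n : (p : Subset n) → ∣ p ∣ + ∣ ∁ p ∣ ≡ n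
∣p∣+∣∁p∣≡n p = trans (cong (∣ p ∣ +_) (∣∁p∣≡n∸∣p∣ p)) (ℕ.m+[n∸m]≡n (∣p∣≤n p))

length-filter-¬filter : {P : A → Set} (P? : Decidable P) (xs : List A) →
  length (filter P? xs) + length (filter (¬? ∘ P?) xs) ≡ length xs
length-filter-¬filter P? [] = refl
length-filter-¬filter P? (x ∷ xs) with P? x
... | yes _ = cong suc (length-filter-¬filter P? xs)
... | no  _ = trans (ℕ.+-suc _ _) (cong suc (length-filter-¬filter P? xs))

-- Pigeonhole by induction on `q`: if the fibre over the top value has at most `j` elements,
-- discarding it leaves more than `q * j` elements with one value fewer.
largeFibre : ∀ j q (f : A → ℕ) {xs : List A} → Unique xs →
  (∀ {x} → x ∈ₗ xs → f x < q) → q * j < length xs →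
  ∃[ c ] ∃[ ys ] (Unique ys × ys ⊆ₗ xs × (∀ {y} → y ∈ₗ ys → f y ≡ c) × j < length ys)
largeFibre j zero    f {x ∷ xs} _ f< _ = contradiction (f< (here refl)) λ ()
largeFibre {A = A} j (suc q) f {xs} ! f< large with j ℕ.<? length (filter (λ x → f x ℕ.≟ q) xs)
... | yes j< = q , _ , Unique.filter⁺ _ ! , (λ {_} → proj₁ ∘ ∈-filter⁻ _) ,
  (λ {_} → proj₂ ∘ ∈-filter⁻ _ {xs = xs}) , j<
... | no j≮ =
  let c , ys , ys! , ys⊆ , f≡c , j< = largeFibre j q f (Unique.filter⁺ (¬? ∘ =q?) !) f<q rest-large
  in  c , ys , ys! , (λ {_} → proj₁ ∘ ∈-filter⁻ (¬? ∘ =q?) ∘ ys⊆) , (λ {_} → f≡c) , j<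
  where
  =q? : Decidable (λ x → f x ≡ q)
  =q? x = f x ℕ.≟ q
  f<q : ∀ {x} → x ∈ₗ filter (¬? ∘ =q?) xs → f x < q
  f<q x∈ with x∈xs , f≢q ← ∈-filter⁻ (¬? ∘ =q?) {xs = xs} x∈ = ℕ.≤∧≢⇒< (s≤s⁻¹ (f< x∈xs)) f≢q
  rest-large : q * j < length (filter (¬? ∘ =q?) xs)
  rest-large = ℕ.+-cancelˡ-< j _ _ (ℕ.<-≤-trans large (ℕ.≤-trans
    (ℕ.≤-reflexive (≡-sym (length-filter-¬filter =q? xs)))
    (ℕ.+-monoˡ-≤ _ (ℕ.≮⇒≥ j≮))))

-- Minimisation and bounded search

least : {P : ℕ → Set} → Decidable P → ∀ m → P m → ∃[ t ] (P t × (∀ s → P s → t ≤ s))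
least P? m Pm with P? zero
... | yes P0 = zero , P0 , λ _ _ → z≤n
least P? zero    P0 | no ¬P0 = contradiction P0 ¬P0
least P? (suc m) Pm | no ¬P0 with t , Pt , min ← least (P? ∘ suc) m Pm =
  suc t , Pt , λ { zero P0 → contradiction P0 ¬P0 ; (suc s) Ps → s≤s (min s Ps) }

-- If every colour were used, choosing a preimage of each would inject `Fin (suc b)` into `Fin b`.
freeColour : ∀ {b} (g : Fin b → Fin (suc b)) → ∃[ c ] (∀ i → g i ≢ c)
freeColour {b} g with any? (λ c → all? (λ i → ¬? (g i ≟ c)))
... | yes p = p
... | no ¬p = contradiction (injective⇒≤ {f = proj₁ ∘ hit} inj) ℕ.1+n≰n
  where
  hit : ∀ c → ∃[ i ] g i ≡ c
  hit c with i , ¬¬eq ← ¬∀⟶∃¬ _ (λ i → g i ≢ c) (λ i → ¬? (g i ≟ c)) (λ all → ¬p (c , all)) =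
    i , decidable-stable (g i ≟ c) ¬¬eq
  inj : Injective _≡_ _≡_ (proj₁ ∘ hit)
  inj {c} {d} eq = trans (≡-sym (proj₂ (hit c))) (trans (cong g eq) (proj₂ (hit d)))

-- White paths and forces

module _ {m n : ℕ} {H : Graph m} {G : Graph n} (f : Fin m → Fin n)
  (f-edge : ∀ {i j} → adj H i j ≡ true → adj G (f i) (f j) ≡ true)
  {C : Coloring H} {D : Coloring G} (f-white : ∀ {i} → ¬ C i → ¬ D (f i)) where

  WPath-map : ∀ {u v} → WPath H C u v → WPath G D (f u) (f v)
  WPath-map (here w)     = here (f-white w)
  WPath-map (step w e p) = step (f-white w) (f-edge e) (WPath-map p)

module _ {n : ℕ} (G : Graph n) where

  WPath-mono : {C D : Coloring G} → (∀ {v} → ¬ C v → ¬ D v) → ∀ {u v} → WPath G C u v → WPath G D u v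
  WPath-mono = WPath-map {H = G} {G = G} id id

  WPath-source : {C : Coloring G} → ∀ {u v} → WPath G C u v → ¬ C u
  WPath-source (here w)     = w
  WPath-source (step w _ _) = w

  WPath-trans : {C : Coloring G} → ∀ {u v w} → WPath G C u v → WPath G C v w → WPath G C u w
  WPath-trans (here _)     q = q
  WPath-trans (step w e p) q = step w e (WPath-trans p q)

  adj-sym : ∀ {u v} → adj G u v ≡ true → adj G v u ≡ true
  adj-sym {u} {v} e = trans (sym G v u) e

  adj-irrefl : ∀ {v} → ¬ adj G v v ≡ true
  adj-irrefl {v} e = contradiction (trans (≡-sym e) (irrefl G v)) λ ()

  WPath-sym : {C : Coloring G} → ∀ {u v} → WPath G C u v → WPath G C v u
  WPath-sym (here w)     = here w
  WPath-sym (step w e p) = WPath-trans (WPath-sym p) (step (WPath-source p) (adj-sym e) (here w))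

  -- More blue vertices mean smaller white components, so `b` sees fewer white rivals of `w`, and
  -- the force can be lost only by `w` turning blue.
  ValidForce-mono : {C D : Coloring G} → (∀ {v} → C v → D v) → ∀ {b w} →
    ¬ D w → ValidForce G C b w → ValidForce G D b w
  ValidForce-mono C⊆D w∉D (b∈C , _ , bw , uniq) =
    C⊆D b∈C , w∉D , bw , λ u u∉D bu p → uniq u (u∉D ∘ C⊆D) bu (WPath-mono (_∘ C⊆D) p)

  -- Decidability

  _∈ₗ?_ : (v : Fin n) (xs : List (Fin n)) → Dec (v ∈ₗ xs)
  v ∈ₗ? xs = Any.any? (v ≟_) xs

  private
    -- Being blue means being absent from the list, so listing the white vertices gives path search
    -- a structure to recurse on.
    White : List (Fin n) → Coloring G
    White xs v = v ∉ₗ xs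

    module _ (x : Fin n) (xs : List (Fin n)) where

      -- Connection to x through a path with all vertices but x in xs.
      Attached : Fin n → Set
      Attached u = u ≡ x ⊎ ∃[ y ] (adj G x y ≡ true × WPath G (White xs) y u)

      white-tail : ∀ {v} → ¬ White (x ∷ xs) v → v ≢ x → ¬ White xs v
      white-tail ¬¬v v≢x v∉xs = ¬¬v λ { (here v≡x) → v≢x v≡x ; (there v∈xs) → v∉xs v∈xs }

      white-weaken : ∀ {v} → ¬ White xs v → ¬ White (x ∷ xs) v
      white-weaken ¬¬v v∉ = ¬¬v (v∉ ∘ there)

      attached⇒path : ∀ {u} → Attached u → WPath G (White (x ∷ xs)) x u
      attached⇒path (inj₁ refl)        = here λ x∉ → x∉ (here refl)
      attached⇒path (inj₂ (y , e , p)) = step (λ x∉ → x∉ (here refl)) e (WPath-mono white-weaken p)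

      -- A path that never visits `x` stays in `xs`; otherwise its pieces before the first and after
      -- the last visit attach both ends to `x`.
      split : ∀ {u v} → WPath G (White (x ∷ xs)) u v →
        WPath G (White xs) u v ⊎ (Attached u × Attached v)
      split {u} (here w) with u ≟ x
      ... | yes u≡x = inj₂ (inj₁ u≡x , inj₁ u≡x)
      ... | no  u≢x = inj₁ (here (white-tail w u≢x))
      split {u} (step w e p) with u ≟ x | split p
      ... | yes u≡x | inj₁ q         = inj₂ (inj₁ u≡x , inj₂ (_ , subst (λ z → adj G z _ ≡ true) u≡x e , q))
      ... | yes u≡x | inj₂ (_ , av)  = inj₂ (inj₁ u≡x , av)
      ... | no  u≢x | inj₁ q         = inj₁ (step (white-tail w u≢x) e q)
      ... | no  u≢x | inj₂ (inj₁ refl , av) = inj₂ (inj₂ (u , adj-sym e , here (white-tail w u≢x)) , av)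
      ... | no  u≢x | inj₂ (inj₂ (y , xy , q) , av) =
        inj₂ (inj₂ (y , xy , WPath-trans q (WPath-sym (step (white-tail w u≢x) e
          (here (WPath-source (WPath-sym q)))))) , av)

    -- The recursion of Floyd and Warshall: admitting one more vertex `x` adds only connections
    -- through `x`, and these reduce to paths within `xs` from its neighbours.
    path-in? : ∀ xs u v → Dec (WPath G (White xs) u v)
    path-in? []       u v = no λ p → WPath-source p λ ()
    path-in? (x ∷ xs) u v = map′ join (split x xs) (path-in? xs u v ⊎-dec (attached? u ×-dec attached? v))
      where
      attached? : Decidable (Attached x xs)
      attached? u = (u ≟ x) ⊎-dec any? (λ y → (adj G x y Bool.≟ true) ×-dec path-in? xs y u)
      join : WPath G (White xs) u v ⊎ (Attached x xs u × Attached x xs v) → WPath G (White (x ∷ xs)) u v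
      join (inj₁ p)         = WPath-mono (white-weaken x xs) p
      join (inj₂ (au , av)) = WPath-trans (WPath-sym (attached⇒path x xs au)) (attached⇒path x xs av)

  module _ {C : Coloring G} (C? : Decidable C) where

    wpath? : ∀ u v → Dec (WPath G C u v)
    wpath? u v = map′ (WPath-mono from) (WPath-mono to) (path-in? whites u v)
      where
      whites = filter (¬? ∘ C?) (allFin n)
      from : ∀ {v} → ¬ White whites v → ¬ C v
      from ¬¬v v∈C = ¬¬v λ v∈ → proj₂ (∈-filter⁻ (¬? ∘ C?) {xs = allFin n} v∈) v∈C
      to : ∀ {v} → ¬ C v → ¬ White whites v
      to {v} v∉C v∉ = v∉ (∈-filter⁺ (¬? ∘ C?) (∈-allFin v) v∉C)

    validForce? : ∀ b w → Dec (ValidForce G C b w)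
    validForce? b w = C? b ×-dec ¬? (C? w) ×-dec (adj G b w Bool.≟ true) ×-dec
      all? (λ u → ¬? (C? u) →-dec ((adj G b u Bool.≟ true) →-dec (wpath? w u →-dec (u ≟ w))))

  addBlue? : {C : Coloring G} → Decidable C → ∀ w → Decidable (addBlue G C w)
  addBlue? C? w v = C? v ⊎-dec (v ≟ w)

  after? : {C : Coloring G} → Decidable C → ∀ fs → Decidable (after G C fs)
  after? C? []             = C?
  after? C? ((b , w) ∷ fs) = after? (addBlue? C? w) fs

  chronValid? : {C : Coloring G} → Decidable C → ∀ fs → Dec (ChronValid G C fs)
  chronValid? C? []             = yes tt
  chronValid? C? ((b , w) ∷ fs) = validForce? C? b w ×-dec chronValid? (addBlue? C? w) fs

  isPSDForces? : ∀ B fs → Dec (IsPSDForces G B fs)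
  isPSDForces? B fs = chronValid? (_∈? B) fs ×-dec
    all? (λ b → all? (λ w → ¬? (validForce? (after? (_∈? B) fs) b w)))

  stage? : ∀ B fs t → Decidable (Stage G B fs t)
  stage? B fs zero    v = v ∈? B
  stage? B fs (suc t) v = stage? B fs t v ⊎-dec
    any? (λ b → Any.any? (Product.≡-dec _≟_ _≟_ (b , v)) fs ×-dec validForce? (stage? B fs t) b v)

  ptF? : ∀ B fs q → Dec (PtF G B fs q)
  ptF? B fs q = all? (stage? B fs q) ×-dec
    map′ (λ f q′ → f {q′}) (λ f {q′} → f q′) (ℕ.allUpTo? (λ q′ → ¬? (all? (stage? B fs q′))) q)

  -- Chronological lists and stages

  after-extensive : {C : Coloring G} → ∀ fs {v} → C v → after G C fs v
  after-extensive []       v∈ = v∈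
  after-extensive (_ ∷ fs) v∈ = after-extensive fs (inj₁ v∈)

  target∈after : {C : Coloring G} → ∀ fs {b w} → (b , w) ∈ₗ fs → after G C fs w
  target∈after (_ ∷ fs) (here refl) = after-extensive fs (inj₂ refl)
  target∈after (_ ∷ fs) (there f∈)  = target∈after fs f∈

  targets : List (Force G) → List (Fin n)
  targets = map proj₂

  targets-white : {C : Coloring G} → ∀ fs → ChronValid G C fs → ∀ {w} → w ∈ₗ targets fs → ¬ C w
  targets-white (_ ∷ fs) (vf , _) (here refl) = proj₁ (proj₂ vf)
  targets-white (_ ∷ fs) (_ , cv) (there w∈)  = targets-white fs cv w∈ ∘ inj₁

  targets-! : {C : Coloring G} → ∀ fs → ChronValid G C fs → Unique (targets fs)
  targets-! []       _        = []
  targets-! (_ ∷ fs) (_ , cv) =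
    All.tabulate (λ v∈ eq → targets-white fs cv v∈ (inj₂ (≡-sym eq))) ∷ targets-! fs cv

  -- A target is white when forced and blue ever after, so no vertex is forced twice. This makes the
  -- search over force lists finite.
  length≤n : {C : Coloring G} → ∀ fs → ChronValid G C fs → length fs ≤ n
  length≤n fs cv = subst (_≤ n) (length-map proj₂ fs) (Unique⇒length≤n (targets-! fs cv))

  stage⊆after : ∀ B fs t {v} → Stage G B fs t v → after G (toColoring G B) fs v
  stage⊆after B fs zero    v∈                  = after-extensive fs v∈
  stage⊆after B fs (suc t) (inj₁ v∈)           = stage⊆after B fs t v∈
  stage⊆after B fs (suc t) (inj₂ (_ , f∈ , _)) = target∈after fs f∈

  -- One time step is allowed per force. When its turn comes, the stage contains all that is blue in
  -- the chronological process, so by `ValidForce-mono` the force is valid there unless its target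
  -- is already blue. `F` stays the full list while `fs` is what remains of it.
  after⊆stage : ∀ B F {C : Coloring G} fs t → fs ⊆ₗ F → (∀ {v} → C v → Stage G B F t v) →
    ChronValid G C fs → ∀ {v} → after G C fs v → Stage G B F (length fs + t) v
  after⊆stage B F []             t _    C⊆ _         v∈ = C⊆ v∈
  after⊆stage B F {C} ((b , w) ∷ fs) t fs⊆F C⊆ (vf , cv) {v} v∈ =
    subst (λ s → Stage G B F s v) (ℕ.+-suc (length fs) t)
      (after⊆stage B F fs (suc t) (fs⊆F ∘ there) C′⊆ cv v∈)
    where
    C′⊆ : ∀ {u} → addBlue G C w u → Stage G B F (suc t) u
    C′⊆ (inj₁ u∈)   = inj₁ (C⊆ u∈)
    C′⊆ (inj₂ refl) with stage? B F t w
    ... | yes w∈ = inj₁ w∈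
    ... | no  w∉ = inj₂ (b , fs⊆F (here refl) , ValidForce-mono C⊆ w∉ vf)

  -- By time `length fs` the stages have caught up with the whole list, and that length is at most
  -- `n`.
  PtF⇒≤n : ∀ {B fs q} → IsPSDForces G B fs → PtF G B fs q → q ≤ n
  PtF⇒≤n {B} {fs} {q} (cv , _) (all , minimal) = ℕ.≮⇒≥ λ n<q →
    minimal (length fs + 0) (ℕ.≤-<-trans (ℕ.≤-trans (ℕ.≤-reflexive (ℕ.+-identityʳ _)) (length≤n fs cv)) n<q)
      λ v → after⊆stage B fs fs 0 id id cv (stage⊆after B fs q (all v))

  PtF⇒forcing : ∀ {B fs q} → IsPSDForces G B fs → PtF G B fs q → IsPSDForcingSet G B
  PtF⇒forcing {B} {fs} {q} psd (all , _) = fs , psd , λ v → stage⊆after B fs q (all v)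

  -- Exhaustive search for propagation times and minima

  boundedForces? : {P : List (Force G) → Set} → Decidable P → ∀ l → Dec (∃[ fs ] (length fs ≤ l × P fs))
  boundedForces? P? zero = map′ (λ P[] → [] , z≤n , P[]) (λ { ([] , _ , P[]) → P[] }) (P? [])
  boundedForces? {P} P? (suc l) = map′ to from
    (P? [] ⊎-dec any? (λ b → any? (λ w → boundedForces? (P? ∘ ((b , w) ∷_)) l)))
    where
    to : P [] ⊎ ∃[ b ] ∃[ w ] ∃[ fs ] (length fs ≤ l × P ((b , w) ∷ fs)) →
         ∃[ fs ] (length fs ≤ suc l × P fs)
    to (inj₁ P[])                     = [] , z≤n , P[]
    to (inj₂ (b , w , fs , fs≤ , Pfs)) = (b , w) ∷ fs , s≤s fs≤ , Pfs
    from : ∃[ fs ] (length fs ≤ suc l × P fs) →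
           P [] ⊎ ∃[ b ] ∃[ w ] ∃[ fs ] (length fs ≤ l × P ((b , w) ∷ fs))
    from ([] , _ , P[])                   = inj₁ P[]
    from ((b , w) ∷ fs , s≤s fs≤ , Pfs) = inj₂ (b , w , fs , fs≤ , Pfs)

  Achieves : Subset n → ℕ → Set
  Achieves B q = ∃[ fs ] (IsPSDForces G B fs × PtF G B fs q)

  achieves? : ∀ B q → Dec (Achieves B q)
  achieves? B q = map′ (λ (fs , _ , p) → fs , p) (λ (fs , psd , ptf) → fs , length≤n fs (proj₁ psd) , psd , ptf)
    (boundedForces? (λ fs → isPSDForces? B fs ×-dec ptF? B fs q) n)

  pt? : ∀ B p → Dec (Pt G B p)
  pt? B p = map′ to from (achieves? B p ×-dec ℕ.allUpTo? (¬? ∘ achieves? B) p)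
    where
    to : Achieves B p × (∀ {q} → q < p → ¬ Achieves B q) → Pt G B p
    to (a , minimal) = a , λ fs q psd ptf → ℕ.≮⇒≥ λ q<p → minimal q<p (fs , psd , ptf)
    from : Pt G B p → Achieves B p × (∀ {q} → q < p → ¬ Achieves B q)
    from (a , minimal) = a , λ q<p (fs , psd , ptf) → ℕ.<⇒≱ q<p (minimal fs _ psd ptf)

  Pt⇒≤n : ∀ {B p} → Pt G B p → p ≤ n
  Pt⇒≤n ((_ , psd , ptf) , _) = PtF⇒≤n psd ptf

  proper? : ∀ B → Dec (ProperSubset G B)
  proper? B = any? (λ v → ¬? (v ∈? B))

  thStar : ∀ {B p} → ProperSubset G B → Pt G B p → ∃[ t ] (ThStar G t × t ≤ ∣ B ∣ * p)
  thStar {B} {p} proper pt =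
    let t , (B′ , p′ , _ , proper′ , pt′ , eq) , minimal = least value? (∣ B ∣ * p) (value proper pt)
    in  t , ((B′ , p′ , proper′ , pt′ , eq) , λ B p proper pt → minimal _ (value proper pt)) ,
        minimal _ (value proper pt)
    where
    Value : ℕ → Set
    -- The bound on `p` makes the search finite and, by `Pt⇒≤n`, loses no pair.
    Value t = ∃[ B ] ∃[ p ] (p < suc n × ProperSubset G B × Pt G B p × ∣ B ∣ * p ≡ t)
    value? : Decidable Value
    value? t = anySubset? λ B → ℕ.anyUpTo?
      (λ p → proper? B ×-dec pt? B p ×-dec (∣ B ∣ * p ℕ.≟ t)) (suc n)
    value : ∀ {B p} → ProperSubset G B → Pt G B p → Value (∣ B ∣ * p)
    value {B} {p} proper pt = B , p , s≤s (Pt⇒≤n pt) , proper , pt , refl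

  kplus : ∀ {B p} → Pt G B p → ∃[ m ] (Kplus G p m × m ≤ ∣ B ∣)
  kplus {B} {p} pt =
    let m , (B′ , pt′ , eq) , minimal = least size? ∣ B ∣ (B , pt , refl)
        _ , psd , ptf = proj₁ pt′
    in  m , ((B′ , PtF⇒forcing psd ptf , pt′ , eq) , λ B _ pt → minimal _ (B , pt , refl)) ,
        minimal _ (B , pt , refl)
    where
    size? : Decidable (λ m → ∃[ B ] (Pt G B p × ∣ B ∣ ≡ m))
    size? m = anySubset? λ B → pt? B p ×-dec (∣ B ∣ ℕ.≟ m)

  -- Forcing in one step

  -- All forces are valid in the fixed coloring `C`, while `C′` is the coloring reached once some of
  -- them have been carried out. `ValidForce-mono` keeps the remaining ones valid.
  simultaneous : {C C′ : Coloring G} → (∀ {v} → C v → C′ v) → {ws : List (Fin n)} → Unique ws →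
    (∀ {w} → w ∈ₗ ws → ¬ C′ w) → (∀ {w} → w ∈ₗ ws → ∃[ b ] ValidForce G C b w) →
    ∃[ fs ] (ChronValid G C′ fs × (∀ {w} → w ∈ₗ ws → ∃[ b ] ((b , w) ∈ₗ fs × ValidForce G C b w)))
  simultaneous C⊆C′ {[]}     _        _     _     = [] , tt , λ ()
  simultaneous C⊆C′ {w ∷ ws} (w∉ ∷ !) white force
    with b , vf ← force (here refl)
    with fs , cv , hit ← simultaneous {C′ = addBlue G _ w} (inj₁ ∘ C⊆C′) !
      (λ { u∈ (inj₁ u∈C′) → white (there u∈) u∈C′ ; u∈ (inj₂ refl) → contradiction refl (All.lookup w∉ u∈) })
      (force ∘ there)
    = (b , w) ∷ fs , (ValidForce-mono C⊆C′ (white (here refl)) vf , cv) ,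
      λ { (here refl) → b , here refl , vf
        ; (there u∈) → let b′ , f∈ , vf′ = hit u∈ in b′ , there f∈ , vf′ }

  module _ {B : Subset n} (proper : ProperSubset G B)
    (force : ∀ w → w ∉ B → ∃[ b ] ValidForce G (toColoring G B) b w) where

    -- After these forces everything is blue, so no further force is valid and the list is maximal;
    -- `proper` excludes time 0.
    oneStep : ∃[ fs ] (IsPSDForces G B fs × PtF G B fs 1 × (∀ v → v ∉ B ⇔ StageNew G B fs 0 v))
    oneStep =
      let fs , cv , hit = simultaneous {C = toColoring G B} id (elements-! (∁ B))
            (x∈∁p⇒x∉p ∘ ∈-elements⁻) (λ {w} w∈ → force w (x∈∁p⇒x∉p (∈-elements⁻ w∈)))
          new : ∀ v → v ∉ B → StageNew G B fs 0 v
          new v v∉ = hit (∈-elements⁺ (x∉p⇒x∈∁p v∉))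
          all : AllBlue G (Stage G B fs 1)
          all v = stage₁ new v
      in  fs , (cv , λ b w vf → proj₁ (proj₂ vf) (stage⊆after B fs 1 (all w))) ,
          (all , λ { zero _ all₀ → proj₂ proper (all₀ _) ; (suc _) (s≤s ()) }) ,
          λ v → mk⇔ (new v) (λ (_ , _ , _ , v∉ , _) → v∉)
      where
      stage₁ : ∀ {fs} → (∀ v → v ∉ B → StageNew G B fs 0 v) → ∀ v → Stage G B fs 1 v
      stage₁ new v with v ∈? B
      ... | yes v∈ = inj₁ v∈
      ... | no  v∉ = inj₂ (new v v∉)

    oneStep⇒Pt : Pt G B 1
    oneStep⇒Pt = (proj₁ oneStep , proj₁ (proj₂ oneStep) , proj₁ (proj₂ (proj₂ oneStep))) , λ
      { fs zero    _ (all₀ , _) → contradiction (all₀ _) (proj₂ proper)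
      ; fs (suc q) _ _          → s≤s z≤n }

  -- Supplies both the initial set of size `n - k` obtained from a member of 𝒢₊,ₖ and the one of
  -- size `n - 1` obtained from an edge.
  complement-Pt : {ws : List (Fin n)} → Unique ws → 0 < length ws →
    (∀ {w} → w ∈ₗ ws → ∃[ b ] ValidForce G (_∉ₗ ws) b w) →
    ∃[ B ] (ProperSubset G B × Pt G B 1 × ∣ B ∣ + length ws ≡ n)
  complement-Pt {ws@(w₀ ∷ _)} ! _ force = ∁ S , proper , oneStep⇒Pt proper force′ , size
    where
    S : Subset n
    S = ⟦ _∈ₗ? ws ⟧
    to∈∁ : ∀ {v} → v ∉ₗ ws → v ∈ ∁ S
    to∈∁ v∉ = x∉p⇒x∈∁p (v∉ ∘ ∈-⟦⟧⁻ (_∈ₗ? ws))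
    proper : ProperSubset G (∁ S)
    proper = w₀ , λ w₀∈ → x∈∁p⇒x∉p w₀∈ (∈-⟦⟧⁺ (_∈ₗ? ws) (here refl))
    force′ : ∀ w → w ∉ ∁ S → ∃[ b ] ValidForce G (toColoring G (∁ S)) b w
    force′ w w∉ with w ∈ₗ? ws
    ... | no  w∉ws = contradiction (to∈∁ w∉ws) w∉
    ... | yes w∈ws with b , vf ← force w∈ws = b , ValidForce-mono to∈∁ w∉ vf
    size : ∣ ∁ S ∣ + length ws ≡ n
    size = trans (ℕ.+-comm _ (length ws)) (trans
      (cong (_+ ∣ ∁ S ∣) (Unique⇒length≡∣∣ ! (λ v → mk⇔ (∈-⟦⟧⁺ (_∈ₗ? ws)) (∈-⟦⟧⁻ (_∈ₗ? ws)))))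
      (∣p∣+∣∁p∣≡n S))

-- Finding members of 𝒢₊,ₖ

module _ {n : ℕ} (G : Graph n) (k : ℕ) (1≤k : 1 ≤ k) where

  private
    module Extract {ws : List (Fin n)} (ws-! : Unique ws) (∣ws∣ : length ws ≡ k)
      (force : ∀ {w} → w ∈ₗ ws → ∃[ b ] ValidForce G (_∉ₗ ws) b w) where

      -- The recursion is over a part `us` of `ws`, but the forces refer throughout to the coloring
      -- in which all of `ws` is white.
      forcers : ∀ us → us ⊆ₗ ws → ∃[ bs ] (length bs ≡ length us ×
        (∀ {w} → w ∈ₗ us → ∃[ b ] (b ∈ₗ bs × ValidForce G (_∉ₗ ws) b w)))
      forcers []       _   = [] , refl , λ ()
      forcers (u ∷ us) us⊆ with b , vf ← force (us⊆ (here refl)) | bs , eq , hit ← forcers us (us⊆ ∘ there) =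
        b ∷ bs , cong suc eq , λ
          { (here refl) → b , here refl , vf
          ; (there w∈) → let b′ , b′∈ , vf′ = hit w∈ in b′ , there b′∈ , vf′ }

      bs = proj₁ (forcers ws id)
      -- Several targets may share a forcer, so repetitions are dropped before the list becomes a
      -- vertex set.
      vs = deduplicate _≟_ (ws ++ bs)

      vs-! : Unique vs
      vs-! = deduplicate-! _≟_ (ws ++ bs)

      ∣vs∣≤2k : length vs ≤ 2 * k
      ∣vs∣≤2k = ℕ.≤-trans (length-deduplicate _≟_ (ws ++ bs)) (ℕ.≤-reflexive (begin
        length (ws ++ bs)       ≡⟨ length-++ ws ⟩
        length ws + length bs   ≡⟨ cong₂ _+_ ∣ws∣ (trans (proj₁ (proj₂ (forcers ws id))) ∣ws∣) ⟩
        k + k                   ≡⟨ cong (k +_) (ℕ.+-identityʳ k) ⟨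
        2 * k                   ∎))
        where open ≡-Reasoning

      f : Fin (length vs) → Fin n
      f = lookup vs

      f-inj : Injective _≡_ _≡_ f
      f-inj = lookup-injective vs-!

      f-hits : ∀ {v} → v ∈ₗ ws ++ bs → ∃[ i ] f i ≡ v
      f-hits v∈ = ∈⇒lookup (∈-deduplicate⁺ _≟_ v∈)

      H : Graph (length vs)
      H = record
        { adj    = λ i j → adj G (f i) (f j)
        ; sym    = λ i j → sym G (f i) (f j)
        ; irrefl = λ i → irrefl G (f i) }

      white? : Decidable (λ i → f i ∈ₗ ws)
      white? i = _∈ₗ?_ G (f i) ws

      S B : Subset (length vs)
      S = ⟦ white? ⟧
      B = ∁ S

      ∈B⇒∉ws : ∀ {i} → i ∈ B → f i ∉ₗ ws
      ∈B⇒∉ws i∈ = x∈∁p⇒x∉p i∈ ∘ ∈-⟦⟧⁺ white?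

      ∉ws⇒∈B : ∀ {i} → f i ∉ₗ ws → i ∈ B
      ∉ws⇒∈B fi∉ = x∉p⇒x∈∁p (fi∉ ∘ ∈-⟦⟧⁻ white?)

      ∉B⇒∈ws : ∀ {i} → i ∉ B → f i ∈ₗ ws
      ∉B⇒∈ws {i} i∉ = decidable-stable (white? i) (i∉ ∘ ∉ws⇒∈B)

      ∣S∣≡k : ∣ S ∣ ≡ k
      ∣S∣≡k = trans (≡-sym (length-elements S)) (trans (≡-sym (length-map f (elements S))) (trans
        (ℕ.≤-antisym
          (Unique-⊆⇒length≤ (Unique.map⁺ f-inj (elements-! S)) image⊆ws)
          (Unique-⊆⇒length≤ ws-! ws⊆image))
        ∣ws∣))
        where
        image⊆ws : map f (elements S) ⊆ₗ ws
        image⊆ws v∈ with i , i∈ , refl ← ∈-map⁻ f v∈ = ∈-⟦⟧⁻ white? (∈-elements⁻ i∈)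
        ws⊆image : ws ⊆ₗ map f (elements S)
        ws⊆image v∈ with i , refl ← f-hits (∈-++⁺ˡ v∈) = ∈-map⁺ f (∈-elements⁺ (∈-⟦⟧⁺ white? v∈))

      properB : ProperSubset H B
      properB =
        let w , w∈ = nonempty (subst (1 ≤_) (≡-sym ∣ws∣) 1≤k)
            i , fi≡w = f-hits (∈-++⁺ˡ w∈)
        in  i , λ i∈ → ∈B⇒∉ws i∈ (subst (_∈ₗ ws) (≡-sym fi≡w) w∈)

      -- White paths of `H` are white paths of `G`, so a second white neighbour in the same
      -- component of `H` would violate uniqueness in `G`.
      forceH : ∀ i → i ∉ B → ∃[ b ] ValidForce H (toColoring H B) b i
      forceH i i∉
        with b , b∈ , b∉ws , _ , bw , uniq ← proj₂ (proj₂ (forcers ws id)) (∉B⇒∈ws i∉)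
        with b′ , refl ← f-hits (∈-++⁺ʳ ws b∈) =
        b′ , ∉ws⇒∈B b∉ws , i∉ , bw , λ u u∉B bu p →
          f-inj (uniq (f u) (u∉B ∘ ∉ws⇒∈B) bu (WPath-map {H = H} {G = G} f id (_∘ ∉ws⇒∈B) p))

      containsGk : ContainsGk G k
      containsGk =
        let fs , psd , ptf , new = oneStep H properB forceH
        in  length vs , H ,
            (∣vs∣≤2k , B , fs , PtF⇒forcing H psd ptf , psd , oneStep⇒Pt H properB forceH , ptf ,
              S , (λ v → mk⇔
                (λ v∈ → Equivalence.to (new v) λ v∈B → x∈∁p⇒x∉p v∈B v∈)
                (λ v∈ → ∈-⟦⟧⁺ white? (∉B⇒∈ws (Equivalence.from (new v) v∈)))) , ∣S∣≡k) ,
            f , f-inj , λ _ _ → refl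

  -- The targets are white in `D`, so leaving only the first `k` of them white keeps every blue
  -- vertex of `D` blue, and `ValidForce-mono` preserves their forces.
  simultaneous⇒containsGk : {D : Coloring G} {ws : List (Fin n)} → Unique ws → k ≤ length ws →
    (∀ {w} → w ∈ₗ ws → ∃[ b ] ValidForce G D b w) → ContainsGk G k
  simultaneous⇒containsGk {D} {ws} ! k≤ force = Extract.containsGk (Unique.take⁺ k !)
    (trans (length-take k ws) (ℕ.m≤n⇒m⊓n≡m k≤)) force′
    where
    force′ : ∀ {w} → w ∈ₗ take k ws → ∃[ b ] ValidForce G (_∉ₗ take k ws) b w
    force′ w∈ with b , vf ← force (∈-take⁻ k w∈) = b , ValidForce-mono G
      (λ v∈D v∈ → proj₁ (proj₂ (proj₂ (force (∈-take⁻ k v∈)))) v∈D)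
      (λ w∉ → w∉ w∈) vf

-- Colouring the forced vertices

module _ {n : ℕ} (G : Graph n) {β : ℕ} where

  -- The blue boundary of the white component of v has at most β vertices.
  Boundary : Coloring G → Fin n → Set
  Boundary C v = Σ (Fin β → Fin n) λ A →
    ∀ {u x} → WPath G C v u → C x → adj G x u ≡ true → ∃[ i ] A i ≡ x

  -- After b → w, the vertex b has no white neighbour left in the component of w,
  -- so w takes the place of b in the boundary of each remaining part of it.
  boundary-step : {C : Coloring G} → Decidable C → ∀ {b w} → ValidForce G C b w →
    (∀ v → ¬ C v → Boundary C v) → ∀ v → ¬ addBlue G C w v → Boundary (addBlue G C w) v
  boundary-step {C} C? {b} {w} (b∈C , w∉C , bw , uniq) bd v v∉ with bd v (v∉ ∘ inj₁) | wpath? G C? v w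
  -- Here `w` is not connected to `v`, so it has no neighbour in the component of `v` and the old
  -- boundary still serves.
  ... | A , covers | no v≁w = A , λ
    { p (inj₁ x∈C)  xu → covers (restrict p) x∈C xu
    ; p (inj₂ refl) wu → contradiction
        (WPath-trans G (restrict p) (step (WPath-source G (WPath-sym G (restrict p))) (adj-sym G wu) (here w∉C))) v≁w }
    where
    restrict : ∀ {u} → WPath G (addBlue G C w) v u → WPath G C v u
    restrict = WPath-mono G (_∘ inj₁)
  ... | A , covers | yes v∼w = A′ , covers′
    where
    restrict : ∀ {u} → WPath G (addBlue G C w) v u → WPath G C v u
    restrict = WPath-mono G (_∘ inj₁)
    A′ : Fin β → Fin n
    A′ i with A i ≟ b
    ... | yes _ = w
    ... | no  _ = A i
    A′-new : ∀ {i} → A i ≡ b → A′ i ≡ w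
    A′-new {i} eq with A i ≟ b
    ... | yes _  = refl
    ... | no neq = contradiction eq neq
    A′-old : ∀ {i} → A i ≢ b → A′ i ≡ A i
    A′-old {i} neq with A i ≟ b
    ... | yes eq = contradiction eq neq
    ... | no _   = refl
    covers′ : ∀ {u x} → WPath G (addBlue G C w) v u → addBlue G C w x → adj G x u ≡ true → ∃[ i ] A′ i ≡ x
    covers′ p (inj₂ refl) _ = let i , eq = covers v∼w b∈C bw in i , A′-new eq
    covers′ {u} {x} p (inj₁ x∈C) xu with i , refl ← covers (restrict p) x∈C xu | A i ≟ b
    ... | no  x≢b  = i , A′-old x≢b
    -- A white neighbour `u` of `b` connected to `v` was in the component of `w`, hence is `w`
    -- itself, which is now blue.
    ... | yes refl = contradiction (inj₂ (uniq u (u∉ ∘ inj₁) xu (WPath-trans G (WPath-sym G v∼w) (restrict p)))) u∉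
      where
      u∉ = WPath-source G (WPath-sym G p)

  -- Ignoring edges that meet `B` makes the condition vacuous at the start, so any constant
  -- colouring can seed the greedy one.
  ProperOutside : Subset n → Coloring G → (Fin n → Fin (suc β)) → Set
  ProperOutside B C c = ∀ {u v} → C u → C v → u ∉ B → v ∉ B → adj G u v ≡ true → c u ≢ c v

  -- The blue neighbours of `w` lie in its boundary, which blocks at most `β` of the `suc β` colours
  -- at the moment `w` is forced.
  colour : ∀ {B C} → Decidable C → (∀ v → ¬ C v → Boundary C v) → ∀ fs → ChronValid G C fs →
    ∃ (ProperOutside B C) → ∃ (ProperOutside B (after G C fs))
  colour C? bd [] _ col = col
  colour {B} {C} C? bd ((b , w) ∷ fs) (vf@(_ , w∉C , _) , cv) (c , proper)
    with A , covers ← bd w w∉C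
    with free , avoids ← freeColour (c ∘ A) =
    colour (addBlue? G C? w) (boundary-step C? vf bd) fs cv (c′ , proper′)
    where
    c′ : Fin n → Fin (suc β)
    c′ v with v ≟ w
    ... | yes _ = free
    ... | no  _ = c v
    c′-new : c′ w ≡ free
    c′-new with w ≟ w
    ... | yes _  = refl
    ... | no w≢w = contradiction refl w≢w
    c′-old : ∀ {v} → C v → c′ v ≡ c v
    c′-old {v} v∈C with v ≟ w
    ... | yes refl = contradiction v∈C w∉C
    ... | no _     = refl
    fresh : ∀ {v} → C v → adj G v w ≡ true → c′ v ≢ c′ w
    fresh v∈C vw eq with i , refl ← covers (here w∉C) v∈C vw =
      avoids i (trans (≡-sym (c′-old v∈C)) (trans eq c′-new))
    proper′ : ProperOutside B (addBlue G C w) c′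
    proper′ (inj₁ u∈)   (inj₁ v∈)   u∉ v∉ uv eq =
      proper u∈ v∈ u∉ v∉ uv (trans (≡-sym (c′-old u∈)) (trans eq (c′-old v∈)))
    proper′ (inj₁ u∈)   (inj₂ refl) _  _  uv eq = fresh u∈ uv eq
    proper′ (inj₂ refl) (inj₁ v∈)   _  _  uv eq = fresh v∈ (adj-sym G uv) (≡-sym eq)
    proper′ (inj₂ refl) (inj₂ refl) _  _  uv _  = adj-irrefl G uv

-- Lower bounds in the absence of members of 𝒢₊,ₖ

module _ {n : ℕ} (G : Graph n) {j : ℕ} (free : ¬ ContainsGk G (suc j)) where

  -- Here `k` is written `suc j`, so that `j` stands for `k - 1`.
  simultaneous≤ : {D : Coloring G} {ws : List (Fin n)} → Unique ws →
    (∀ {w} → w ∈ₗ ws → ∃[ b ] ValidForce G D b w) → length ws ≤ j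
  simultaneous≤ ! force = ℕ.≮⇒≥ λ j< → free (simultaneous⇒containsGk G (suc j) (s≤s z≤n) ! j< force)

  module _ {B : Subset n} {fs : List (Force G)} {p : ℕ}
    (psd : IsPSDForces G B fs) (ptf : PtF G B fs p) where

    private
      all-after : AllBlue G (after G (toColoring G B) fs)
      all-after v = stage⊆after G B fs p (proj₁ ptf v)

      outside⇒new : ∀ q {v} → v ∉ B → Stage G B fs q v → ∃[ t ] (t < q × StageNew G B fs t v)
      outside⇒new zero    v∉ v∈        = contradiction v∈ v∉
      outside⇒new (suc q) v∉ (inj₂ new) = q , ℕ.n<1+n q , new
      outside⇒new (suc q) v∉ (inj₁ v∈)  with t , t<q , new ← outside⇒new q v∉ v∈ = t , ℕ.m<n⇒m<1+n t<q , new

      white⇒∉B : ∀ {v} → v ∈ₗ elements (∁ B) → v ∉ B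
      white⇒∉B = x∈∁p⇒x∉p ∘ ∈-elements⁻

      whites≤ : ∀ {s} → length (elements (∁ B)) ≤ s → n ≤ ∣ B ∣ + s
      whites≤ {s} h = ℕ.≤-trans (ℕ.≤-reflexive (≡-sym (∣p∣+∣∁p∣≡n B)))
        (ℕ.+-monoʳ-≤ ∣ B ∣ (subst (_≤ s) (length-elements (∁ B)) h))

    -- The vertices coloured at one time step are forced simultaneously.
    n≤∣B∣+pj : n ≤ ∣ B ∣ + p * j
    n≤∣B∣+pj = whites≤ (ℕ.≮⇒≥ λ large →
      let t , ws , ws! , ws⊆ , time≡t , j< = largeFibre j p time (elements-! (∁ B)) (time< ∘ white⇒∉B) large
      in  ℕ.<⇒≱ j< (simultaneous≤ {D = Stage G B fs t} ws! λ w∈ →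
            let b , _ , vf = time-new (white⇒∉B (ws⊆ w∈))
            in  b , subst (λ s → ValidForce G (Stage G B fs s) b _) (time≡t w∈) vf))
      where
      time : Fin n → ℕ
      time v with v ∈? B
      -- A placeholder value: fibres of `time` are taken only among vertices outside `B`.
      ... | yes _  = 0
      ... | no  v∉ = proj₁ (outside⇒new p v∉ (proj₁ ptf v))
      time< : ∀ {v} → v ∉ B → time v < p
      time< {v} v∉ with v ∈? B
      ... | yes v∈ = contradiction v∈ v∉
      ... | no  v∉ = proj₁ (proj₂ (outside⇒new p v∉ (proj₁ ptf v)))
      time-new : ∀ {v} → v ∉ B → StageNew G B fs (time v) v
      time-new {v} v∉ with v ∈? B
      ... | yes v∈ = contradiction v∈ v∉
      ... | no  v∉ = proj₂ (proj₂ (outside⇒new p v∉ (proj₁ ptf v)))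

    -- In a set of independent white vertices each vertex is its own component,
    -- so any neighbours force them simultaneously.
    n≤∣B∣+[1+∣B∣]j : n ≤ ∣ B ∣ + suc ∣ B ∣ * j
    n≤∣B∣+[1+∣B∣]j = whites≤ (ℕ.≮⇒≥ λ large →
      let κ , ws , ws! , ws⊆ , colour≡κ , j< =
            largeFibre j (suc ∣ B ∣) (toℕ ∘ c) (elements-! (∁ B)) (λ {v} _ → toℕ<n (c v)) large
      in  ℕ.<⇒≱ j< (simultaneous≤ {D = _∉ₗ ws} ws!
            (independent (white⇒∉B ∘ ws⊆) λ u∈ v∈ → toℕ-injective (trans (colour≡κ u∈) (≡-sym (colour≡κ v∈))))))
      where
      boundary₀ : ∀ v → v ∉ B → Boundary G {∣ B ∣} (toColoring G B) v
      -- Before any force, the whole of `B` serves as the boundary of every component.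
      boundary₀ v _ = subst (λ β → Boundary G {β} (toColoring G B) v)
        (length-elements B) (lookup (elements B) , λ _ x∈ _ → ∈⇒lookup (∈-elements⁺ x∈))
      coloured : ∃ (ProperOutside G B (after G (toColoring G B) fs))
      coloured = colour G (_∈? B) boundary₀ fs (proj₁ psd) ((λ _ → zero) , λ u∈ _ u∉ → contradiction u∈ u∉)
      c : Fin n → Fin (suc ∣ B ∣)
      c = proj₁ coloured
      independent : ∀ {ws} → (∀ {v} → v ∈ₗ ws → v ∉ B) → (∀ {u v} → u ∈ₗ ws → v ∈ₗ ws → c u ≡ c v) →
        ∀ {w} → w ∈ₗ ws → ∃[ b ] ValidForce G (_∉ₗ ws) b w
      -- The forcer of `w` in the original process supplies a neighbour, and independence puts it
      -- outside `ws`.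
      independent {ws} ws∉B mono {w} w∈
        with t , _ , b , _ , _ , _ , bw , _ ← outside⇒new p (ws∉B w∈) (proj₁ ptf w) =
        b , (λ b∈ → nonadjacent b∈ w∈ bw) , (λ w∉ → w∉ w∈) , bw , λ
          { u _ _ (here _)       → refl
          ; u _ _ (step _ wx q) → contradiction wx
              (nonadjacent w∈ (decidable-stable (_∈ₗ?_ G _ ws) (WPath-source G q))) }
        where
        nonadjacent : ∀ {u v} → u ∈ₗ ws → v ∈ₗ ws → ¬ adj G u v ≡ true
        nonadjacent u∈ v∈ uv = proj₂ coloured (all-after _) (all-after _) (ws∉B u∈) (ws∉B v∈) uv (mono u∈ v∈)

-- If 2k < β then 2n ≤ 2β + 2pj ≤ 2pβ; otherwise the second bound makes n quadratic in k.
combineBounds : ∀ {j n} β p → 12 * suc j ^ 3 < n → 2 ≤ p →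
  n ≤ β + p * j → n ≤ β + suc β * j → n ≤ β * p
combineBounds {j} {n} β p large 2≤p n≤₁ n≤₂ with β ≤? 2 * suc j
... | yes β≤ = contradiction large (ℕ.≤⇒≯ (begin
  n                                 ≤⟨ n≤₂ ⟩
  β + suc β * j                     ≤⟨ ℕ.+-mono-≤ β≤ (ℕ.*-mono-≤ (s≤s β≤) (ℕ.n≤1+n j)) ⟩
  2 * k + (k + 2 * k * k)           ≡⟨ cong (λ x → 2 * k + (k + x)) (ℕ.*-assoc 2 k k) ⟩
  -- Raising `k` and `k * k` to `k³` leaves five copies of `k³`, which the factor 12 absorbs.
  2 * k + (k + 2 * (k * k))         ≤⟨ ℕ.+-mono-≤ (ℕ.*-monoʳ-≤ 2 k≤k³)
                                         (ℕ.+-mono-≤ k≤k³ (ℕ.*-monoʳ-≤ 2 k²≤k³)) ⟩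
  2 * k³ + 3 * k³                   ≡⟨ ℕ.*-distribʳ-+ k³ 2 3 ⟨
  5 * k³                            ≤⟨ ℕ.*-monoˡ-≤ k³ (ℕ.m≤m+n 5 7) ⟩
  12 * k³                           ∎))
  where
  open ℕ.≤-Reasoning
  k = suc j
  k³ = k ^ 3
  k²≤k³ : k * k ≤ k³
  k²≤k³ = ℕ.≤-trans (ℕ.m≤m*n (k * k) k) (ℕ.≤-reflexive (trans (ℕ.*-assoc k k k)
    (cong (λ x → k * (k * x)) (≡-sym (ℕ.*-identityʳ k)))))
  k≤k³ : k ≤ k³
  k≤k³ = ℕ.≤-trans (ℕ.m≤m*n k k) k²≤k³
... | no β≰ = ℕ.*-cancelˡ-≤ 2 (begin
  2 * n                    ≤⟨ ℕ.*-monoʳ-≤ 2 n≤₁ ⟩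
  2 * (β + p * j)          ≡⟨ ℕ.*-distribˡ-+ 2 β (p * j) ⟩
  2 * β + 2 * (p * j)      ≡⟨ cong (2 * β +_) (ℕ.*-assoc 2 p j) ⟨
  2 * β + 2 * p * j        ≡⟨ cong (λ x → 2 * β + x * j) (ℕ.*-comm 2 p) ⟩
  2 * β + p * 2 * j        ≡⟨ cong (2 * β +_) (ℕ.*-assoc p 2 j) ⟩
  2 * β + p * (2 * j)      ≤⟨ ℕ.+-mono-≤ (ℕ.*-monoˡ-≤ β 2≤p) (ℕ.*-monoʳ-≤ p 2j≤β) ⟩
  p * β + p * β            ≡⟨ cong (p * β +_) (ℕ.+-identityʳ (p * β)) ⟨
  2 * (p * β)              ≡⟨ cong (2 *_) (ℕ.*-comm p β) ⟩
  2 * (β * p)              ∎)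
  where
  open ℕ.≤-Reasoning
  2j≤β : 2 * j ≤ β
  2j≤β = ℕ.≤-trans (ℕ.*-monoʳ-≤ 2 (ℕ.n≤1+n j)) (ℕ.<⇒≤ (ℕ.≰⇒> β≰))

-- Transport of forces from an induced subgraph

module _ {m n : ℕ} {H : Graph m} {G : Graph n} {f : Fin m → Fin n} (f-inj : Injective _≡_ _≡_ f)
  (f-adj : ∀ i j → adj H i j ≡ adj G (f i) (f j)) where

  -- Every white vertex of `G` is the image of a white vertex of `H`, so a white path never leaves
  -- the image and can be pulled back edge by edge.
  WPath-lift : {C : Coloring H} {D : Coloring G} → (∀ {v} → ¬ D v → ∃[ i ] (f i ≡ v × ¬ C i)) →
    ∀ {i v} → WPath G D (f i) v → ∃[ l ] (f l ≡ v × WPath H C i l)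
  WPath-lift {C} lift {i} (here w) with i′ , eq , w′ ← lift w =
    i , refl , here (subst (¬_ ∘ C) (f-inj eq) w′)
  WPath-lift {C} lift {i} (step w e p)
    with i′ , eq , w′ ← lift w | l , refl , _ ← lift (WPath-source G p)
    with l′ , eq′ , q ← WPath-lift lift p =
    l′ , eq′ , step (subst (¬_ ∘ C) (f-inj eq) w′) (trans (f-adj i l) e) q

  -- A rival white neighbour of `f b` would pull back, together with its path from `f w`, to a rival
  -- of `w` in `H`.
  ValidForce-embed : {C : Coloring H} {D : Coloring G} → (∀ {v} → ¬ D v → ∃[ i ] (f i ≡ v × ¬ C i)) →
    (∀ {i} → C i → D (f i)) → ∀ {b w} → ¬ D (f w) → ValidForce H C b w → ValidForce G D (f b) (f w)
  ValidForce-embed {C} {D} lift f-blue {b} {w} w∉D (b∈C , _ , bw , uniq) =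
    f-blue b∈C , w∉D , trans (≡-sym (f-adj b w)) bw , unique
    where
    unique : ∀ u → ¬ D u → adj G (f b) u ≡ true → WPath G D (f w) u → u ≡ f w
    unique u u∉D bu p with i , refl , i∉C ← lift u∉D | l , eq , q ← WPath-lift lift p =
      cong f (uniq i i∉C (trans (f-adj b i) bu) (subst (WPath H C w) (f-inj eq) q))

-- The upper bound and the equality with k₊(G,1)

module _ {n : ℕ} (G : Graph n) where

  -- With only the images of the vertices forced in the first step left white, one step finishes `G`
  -- from `n - k` blue vertices, at product cost `n - k`.
  ContainsGk⇒thStar≤ : ∀ {k} → 1 ≤ k → ContainsGk G k → ∃[ t ] (ThStar G t × t + k ≤ n)
  ContainsGk⇒thStar≤ {k} 1≤k (m , H , (_ , B , fs , _ , _ , _ , (all , _) , S , S⇔new , ∣S∣≡k) , f , f-inj , f-adj) =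
    let B′ , proper , pt , eq = complement-Pt G ws! (subst (1 ≤_) (≡-sym ∣ws∣≡k) 1≤k) force
        t , th , t≤ = thStar G proper pt
    in  t , th , (begin
      t + k              ≤⟨ ℕ.+-monoˡ-≤ k t≤ ⟩
      ∣ B′ ∣ * 1 + k     ≡⟨ cong₂ _+_ (ℕ.*-identityʳ ∣ B′ ∣) (≡-sym ∣ws∣≡k) ⟩
      ∣ B′ ∣ + length ws ≡⟨ eq ⟩
      n                  ∎)
    where
    open ℕ.≤-Reasoning
    ws = map f (elements S)
    ws! : Unique ws
    ws! = Unique.map⁺ f-inj (elements-! S)
    ∣ws∣≡k : length ws ≡ k
    ∣ws∣≡k = trans (length-map f (elements S)) (trans (length-elements S) ∣S∣≡k)
    lift : ∀ {v} → ¬ v ∉ₗ ws → ∃[ i ] (f i ≡ v × i ∉ B)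
    lift ¬¬v with i , i∈ , refl ← ∈-map⁻ f (decidable-stable (_∈ₗ?_ G _ ws) ¬¬v)
      with _ , _ , _ , i∉B , _ ← Equivalence.to (S⇔new i) (∈-elements⁻ i∈) = i , refl , i∉B
    blue : ∀ {i} → i ∈ B → f i ∉ₗ ws
    blue i∈B fi∈ with i′ , eq , i∉B ← lift (λ fi∉ → fi∉ fi∈) = i∉B (subst (_∈ B) (≡-sym (f-inj eq)) i∈B)
    force : ∀ {w} → w ∈ₗ ws → ∃[ b ] ValidForce G (_∉ₗ ws) b w
    force w∈ with i , i∈ , refl ← ∈-map⁻ f w∈
      with b , _ , vf ← Equivalence.to (S⇔new i) (∈-elements⁻ i∈) =
      f b , ValidForce-embed f-inj f-adj lift blue (λ w∉ → w∉ w∈) vf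

  Pt1⇒proper : ∀ {B} → Pt G B 1 → ProperSubset G B
  Pt1⇒proper {B} ((_ , _ , _ , minimal) , _) = ¬∀⟶∃¬ n (_∈ B) (_∈? B) (minimal 0 (s≤s z≤n))

  -- One end of the edge, left as the only white vertex, is forced by the other. This also
  -- guarantees that k₊(G,1) exists.
  edge⇒Pt1 : NonEmpty G → ∃[ B ] (Pt G B 1 × suc ∣ B ∣ ≡ n)
  edge⇒Pt1 (i , j , ij) =
    let B , _ , pt , eq = complement-Pt G {j ∷ []} ([] ∷ []) (s≤s z≤n) force
    in  B , pt , trans (ℕ.+-comm 1 ∣ B ∣) eq
    where
    force : ∀ {w} → w ∈ₗ j ∷ [] → ∃[ b ] ValidForce G (_∉ₗ j ∷ []) b w
    force (here refl) = i , (λ { (here refl) → adj-irrefl G ij }) , (λ j∉ → j∉ (here refl)) , ij , only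
      where
      only : ∀ u → ¬ u ∉ₗ j ∷ [] → adj G i u ≡ true → WPath G (_∉ₗ j ∷ []) j u → u ≡ j
      only u ¬¬u _ _ with u ≟ j
      ... | yes u≡j = u≡j
      ... | no  u≢j = contradiction (λ { (here u≡j) → u≢j u≡j }) ¬¬u

  thStar≡kplus : ∀ {j} → NonEmpty G → ¬ ContainsGk G (suc j) → 12 * suc j ^ 3 < n →
    ∃[ t ] (ThStar G t × Kplus G 1 t × n < t + suc j)
  thStar≡kplus {j} edge free large
    with B , pt , size ← edge⇒Pt1 edge
    with t , k₊@((B₁ , _ , pt₁@((_ , psd₁ , ptf₁) , _) , refl) , minimal) , t≤ ← kplus G pt =
    t , ((B₁ , 1 , Pt1⇒proper pt₁ , pt₁ , ℕ.*-identityʳ t) , lower) , k₊ ,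
    -- At `p = 1` the bound `n≤∣B∣+pj` reads `n ≤ t + j`, and passing to `suc j` makes it strict.
    subst (n <_) (≡-sym (ℕ.+-suc t j)) (s≤s (subst (λ x → n ≤ t + x) (ℕ.*-identityˡ j)
      (n≤∣B∣+pj G free psd₁ ptf₁)))
    where
    lower : ∀ B p → ProperSubset G B → Pt G B p → t ≤ ∣ B ∣ * p
    lower B′ zero (v , v∉) ((_ , _ , all , _) , _) = contradiction (all v) v∉
    lower B′ (suc zero) _ pt′@((_ , psd , ptf) , _) =
      subst (t ≤_) (≡-sym (ℕ.*-identityʳ ∣ B′ ∣)) (minimal B′ (PtF⇒forcing G psd ptf) pt′)
    -- With two or more steps the product is already at least `n`, while the edge keeps `t` below
    -- `n`.
    lower B′ p@(suc (suc _)) _ ((_ , psd , ptf) , _) = ℕ.≤-trans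
      (ℕ.≤-trans t≤ (ℕ.≤-trans (ℕ.n≤1+n ∣ B ∣) (ℕ.≤-reflexive size)))
      (combineBounds ∣ B′ ∣ p large (s≤s (s≤s z≤n)) (n≤∣B∣+pj G free psd ptf) (n≤∣B∣+[1+∣B∣]j G free psd ptf))

theorem3p2 : (∀ (k : ℕ) → 1 ≤ k → ∀ (n : ℕ) (G : Graph n) → ContainsGk G k →
    ∃[ t ] (ThStar G t × t + k ≤ n))
    ×
    (∀ (k n : ℕ) (G : Graph n) → NonEmpty G → ¬ ContainsGk G k →
    1 < k → 12 * k ^ 3 < n →
    ∃[ t ] (ThStar G t × Kplus G 1 t × n < t + k))
theorem3p2 =
  (λ k 1≤k n G → ContainsGk⇒thStar≤ G 1≤k) ,
  λ { (suc j) n G edge free _ → thStar≡kplus G edge free }
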